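{- Let $\mathrm{L}$ be an $n \times n$ matrix with entries in $\mathbb{F}_2$ of the form $$\mathrm{L} = \begin{bmatrix} p_{n-1} & 1 & 0 & 0 & \cdots & 0 \\ p_{n-2} & 0 & 1 & 0 & \cdots & 0 \\ p_{n-3} & 0 & 0 & 1 & \cdots & 0 \\ \vdots & \vdots & \vdots & \vdots & \ddots & \vdots \\ p_1 & 0 & 0 & 0 & \cdots & 1 \\ p_0 & 0 & 0 & 0 & \cdots & 0 \end{bmatrix},$$ i.e. the first column is $(p_{n-1}, p_{n-2}, \dots, p_1, p_0)^T$ with $p_0, \dots, p_{n-1} \in \mathbb{F}_2$, the entry in position $(i,i+1)$ is $1$ for $1 \le i \le n-1$, and all other entries are $0$. Let $\chi(x)$ be the characteristic polynomial of $\mathrm{L}$, and let $\tau$ be the $n \times n$ reflection matrix, whose $(i,j)$ entry is $1$ if $i+j=n+1$ and $0$ otherwise. Then $\mathrm{L}$ satisfies $\mathrm{L} = \tau \cdot \mathrm{L}^n \cdot \tau$ if and only if $\chi(x) = \sum_{j=0}^{n} x^j$.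
   Context: The matrix $\mathrm{L}$ describes the state change $\mathrm{w} \mapsto \mathrm{w} \cdot \mathrm{L}$ of an $n$-bit Fibonacci linear feedback shift register, where $\mathrm{w} = [s_{n-1}\, s_{n-2} \cdots s_1\, s_0]$ is the row of register bits. The characteristic polynomial of $\mathrm{L}$ over $\mathbb{F}_2$ is $\chi(x) = x^n + p_{n-1}x^{n-1} + \cdots + p_1 x + p_0$.
   Formalization: The formal theorem requires n ≥ 2; for n = 1 the claim fails, since L = [0] satisfies L = τ·L·τ while χ(x) = x is not x + 1. -}

module Defs where

open import Algebra.Bundles using (Ring; CommutativeRing)
open import Algebra.Bundles.Raw using (RawRing)
open import Data.Bool.Base using (if_then_else_)
open import Data.Fin.Base using (Fin; zero; suc; toℕ; inject₁; opposite; punchIn)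
open import Data.Fin.Properties using (_≟_)
open import Data.List.Base using (List; []; _∷_; map)
open import Data.Nat.Base as ℕ using (ℕ; zero; suc)
import Data.Nat.Properties as ℕ
import Data.Parity.Properties as ℙ
open import Level using (Level; 0ℓ)
open import Relation.Nullary.Decidable.Core using (does)
import Algebra.Definitions.RawSemiring as RawSemiringDefs

private
  variable
    c ℓ : Level

-- Univariate polynomials as coefficient lists, constant term first.
-- Trailing zeros are allowed, so equality is equality of all coefficients.
module Polynomial (R : RawRing c ℓ) where

  open RawRing R

  Poly : Set c
  Poly = List Carrier

  coeff : Poly → ℕ → Carrier
  coeff []      _       = 0#
  coeff (a ∷ _) zero    = a
  coeff (_ ∷ p) (suc k) = coeff p k

  infix  4 _≈ₚ_
  infixl 6 _+ₚ_
  infixl 7 _*ₚ_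

  _≈ₚ_ : Poly → Poly → Set ℓ
  p ≈ₚ q = ∀ k → coeff p k ≈ coeff q k

  _+ₚ_ : Poly → Poly → Poly
  []      +ₚ q       = q
  (a ∷ p) +ₚ []      = a ∷ p
  (a ∷ p) +ₚ (b ∷ q) = (a + b) ∷ (p +ₚ q)

  _*ₚ_ : Poly → Poly → Poly
  []      *ₚ q = []
  (a ∷ p) *ₚ q = map (a *_) q +ₚ (0# ∷ (p *ₚ q))

  const : Carrier → Poly
  const a = a ∷ []

  X : Poly
  X = 0# ∷ 1# ∷ []

  polyRing : RawRing c ℓ
  polyRing = record
    { Carrier = Poly
    ; _≈_     = _≈ₚ_
    ; _+_     = _+ₚ_
    ; _*_     = _*ₚ_
    ; -_      = map -_
    ; 0#      = []
    ; 1#      = const 1#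
    }

module Matrices (R : RawRing c ℓ) where

  open RawRing R
  open RawSemiringDefs rawSemiring using (sum; _^_)

  Matrix : ℕ → Set c
  Matrix n = Fin n → Fin n → Carrier

  infix  4 _≈ᴹ_
  infixl 7 _·_
  infixr 8 _^ᴹ_

  _≈ᴹ_ : ∀ {n} → Matrix n → Matrix n → Set ℓ
  M ≈ᴹ N = ∀ i j → M i j ≈ N i j

  identity : ∀ {n} → Matrix n
  identity i j = if does (i ≟ j) then 1# else 0#

  _·_ : ∀ {n} → Matrix n → Matrix n → Matrix n
  (M · N) i j = sum (λ k → M i k * N k j)

  _^ᴹ_ : ∀ {n} → Matrix n → ℕ → Matrix n
  M ^ᴹ zero  = identity
  M ^ᴹ suc k = M · M ^ᴹ k

  -- Laplace expansion along the first row.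
  det : ∀ {n} → Matrix n → Carrier
  det {zero}  M = 1#
  det {suc n} M =
    sum (λ j → (- 1#) ^ toℕ j * (M zero j * det (λ i k → M (suc i) (punchIn j k))))

  -- Indices start at 0 here, hence the shifts in i + j = n + 1.
  reflection : ∀ {n} → Matrix n
  reflection {n} i j =
    if does (suc (toℕ i) ℕ.+ suc (toℕ j) ℕ.≟ n ℕ.+ 1) then 1# else 0#

  -- With p = (p₀ , … , pₙ₋₁), the first column read from the top is
  -- pₙ₋₁ , … , p₀, since opposite i is n - 1 - i.
  companion : ∀ {n} → (Fin n → Carrier) → Matrix n
  companion p i zero    = p (opposite i)
  companion p i (suc j) = if does (i ≟ inject₁ j) then 1# else 0#

module CharacteristicPolynomial (R : RawRing c ℓ) where

  open Polynomial R
  open Matrices R using (Matrix)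
  open RawRing polyRing using (_+_; _*_; -_)
  open Matrices polyRing using (det; identity)

  -- det (X I - M), computed over R[X].
  charPoly : ∀ {n} → Matrix n → Poly
  charPoly M = det (λ i j → X * identity i j + - const (M i j))

-- The two-element field, realised as the integers modulo 2.
𝔽₂ : RawRing 0ℓ 0ℓ
𝔽₂ = Ring.rawRing (CommutativeRing.ring ℙ.+-*-commutativeRing)

open Polynomial 𝔽₂ public
open Matrices 𝔽₂ public
open CharacteristicPolynomial 𝔽₂ public
open RawSemiringDefs (RawRing.rawSemiring polyRing) public
  using () renaming (sum to sumₚ; _^_ to _^ₚ_)

-- Both sides are equivalent to p₀ = … = pₙ₋₁ = 1. Over any ring χ = xⁿ - Σ pⱼ xʲ, which
-- settles the right-hand side. On the left, L shifts columns, column j + 1 of Lᵏ⁺¹ being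
-- column j of Lᵏ, so column j of τ Lⁿ τ is the reversed first column of Lʲ⁺¹. For j = 1 the
-- equation reads p₀ pₙ₋₁ = 1 and pᵢ₊₁ pₙ₋₁ + pᵢ = 0, which forces every pᵢ to be 1;
-- conversely, if all pᵢ are 1, iterating the recurrence of the first columns gives the
-- columns of L.

module Submission where

open import Defs using (module Polynomial; module Matrices; module CharacteristicPolynomial)
open import Algebra.Bundles using (Monoid; Ring)
open import Algebra.Bundles.Raw using (RawRing)
import Algebra.Definitions.RawSemiring as RawSemiringDefs
import Algebra.Properties.CommutativeSemigroup as CommutativeSemigroupProperties
import Algebra.Properties.Monoid.Sum as MonoidSum
import Algebra.Properties.Ring as RingProperties
import Algebra.Properties.Semiring.Sum as SemiringSum
open import Data.Bool.Base using (if_then_else_; true; false)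
open import Data.Fin.Base using (Fin; zero; suc; toℕ; fromℕ; inject₁; opposite; punchIn)
open import Data.Fin.Induction using (<-weakInduction)
import Data.Fin.Permutation as Perm
open import Data.Fin.Properties
  using (_≟_; fromℕ≢inject₁; inject₁-injective; opposite-involutive; opposite-prop; suc-injective; toℕ-fromℕ;
         toℕ-inject₁; toℕ-injective; toℕ<n)
open import Data.List.Base using ([]; _∷_; map)
open import Data.Nat.Base as ℕ using (ℕ; zero; suc; _≤_; s≤s)
import Data.Nat.Properties as ℕ
import Data.Parity.Properties as ℙ
open import Data.Product.Base using (_,_)
open import Data.Vec.Functional using (Vector)
open import Function.Base using (_∘_; _$_)
open import Function.Bundles using (_⇔_; mk⇔)
open import Function.Construct.Composition using (_⇔-∘_)
open import Function.Construct.Symmetry using (⇔-sym)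
open import Level using (Level)
open import Relation.Binary.PropositionalEquality as ≡ using (_≡_; _≢_)
import Relation.Binary.Reasoning.Setoid as SetoidReasoning
open import Relation.Nullary.Decidable using (does; dec-true; dec-false; does-⇔)
open import Relation.Nullary.Negation using (contradiction)

private
  variable
    c ℓ : Level

-- Finite sums with at most one nontrivial term.

module _ (M : Monoid c ℓ) where

  open Monoid M
  open MonoidSum M using (sum; sum-cong-≋; sum-replicate-zero)

  sum-zero : ∀ {n} (t : Vector Carrier n) → (∀ i → t i ≈ ε) → sum t ≈ ε
  sum-zero {n} t t≈0 = trans (sum-cong-≋ {n} t≈0) (sum-replicate-zero n)

  sum-single : ∀ {n} (t : Vector Carrier n) i → (∀ j → j ≢ i → t j ≈ ε) → sum t ≈ t i
  sum-single t zero    off = trans (∙-congˡ (sum-zero (t ∘ suc) (λ j → off (suc j) λ ()))) (identityʳ _)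
  sum-single t (suc i) off = trans
    (∙-cong (off zero λ ()) (sum-single (t ∘ suc) i (λ j j≢i → off (suc j) (j≢i ∘ suc-injective))))
    (identityˡ _)

-- The ring of polynomials, with equality tested on coefficients.

module PolynomialRing (R : Ring c ℓ) where

  open Ring R hiding (_-_; zero)
  open RingProperties R using (-0#≈0#)
  open CommutativeSemigroupProperties +-commutativeSemigroup using (interchange)
  open Polynomial rawRing
  open SetoidReasoning setoid

  scale : Carrier → Poly → Poly
  scale a = map (a *_)

  coeff-+ : ∀ p q k → coeff (p +ₚ q) k ≈ coeff p k + coeff q k
  coeff-+ []      q       k       = sym (+-identityˡ _)
  coeff-+ (a ∷ p) []      k       = sym (+-identityʳ _)
  coeff-+ (a ∷ p) (b ∷ q) zero    = refl
  coeff-+ (a ∷ p) (b ∷ q) (suc k) = coeff-+ p q k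

  coeff-scale : ∀ a p k → coeff (scale a p) k ≈ a * coeff p k
  coeff-scale a []      k       = sym (zeroʳ a)
  coeff-scale a (b ∷ p) zero    = refl
  coeff-scale a (b ∷ p) (suc k) = coeff-scale a p k

  coeff-neg : ∀ p k → coeff (map -_ p) k ≈ - coeff p k
  coeff-neg []      k       = sym -0#≈0#
  coeff-neg (a ∷ p) zero    = refl
  coeff-neg (a ∷ p) (suc k) = coeff-neg p k

  shift-cong : ∀ p q → p ≈ₚ q → (0# ∷ p) ≈ₚ (0# ∷ q)
  shift-cong p q p≈q zero    = refl
  shift-cong p q p≈q (suc k) = p≈q k

  shift-zero : (0# ∷ []) ≈ₚ []
  shift-zero zero    = refl
  shift-zero (suc k) = refl

  coeff-shift-+ : ∀ p q k → coeff (0# ∷ (p +ₚ q)) k ≈ coeff (0# ∷ p) k + coeff (0# ∷ q) k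
  coeff-shift-+ p q zero    = sym (+-identityˡ 0#)
  coeff-shift-+ p q (suc k) = coeff-+ p q k

  coeff-shift-scale : ∀ a p k → coeff (0# ∷ scale a p) k ≈ a * coeff (0# ∷ p) k
  coeff-shift-scale a p zero    = sym (zeroʳ a)
  coeff-shift-scale a p (suc k) = coeff-scale a p k

  -- Lists that differ in trailing zeros are equal polynomials, so products have to be compared
  -- coefficientwise. This recursion drives the inductions on the left factor in the ring laws.
  coeff-∷-* : ∀ a p q k → coeff ((a ∷ p) *ₚ q) k ≈ a * coeff q k + coeff (0# ∷ (p *ₚ q)) k
  coeff-∷-* a p q k = trans (coeff-+ (scale a q) _ k) (+-congʳ (coeff-scale a q k))

  coeff-shift-* : ∀ p q k → coeff ((0# ∷ p) *ₚ q) k ≈ coeff (0# ∷ (p *ₚ q)) k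
  coeff-shift-* p q k = trans (coeff-∷-* 0# p q k) (trans (+-congʳ (zeroˡ _)) (+-identityˡ _))

  coeff-const-* : ∀ a p k → coeff (const a *ₚ p) k ≈ a * coeff p k
  coeff-const-* a p k = trans (coeff-∷-* a [] p k) (trans (+-congˡ (shift-zero k)) (+-identityʳ _))

  +ₚ-cong : ∀ p p′ q q′ → p ≈ₚ p′ → q ≈ₚ q′ → p +ₚ q ≈ₚ p′ +ₚ q′
  +ₚ-cong p p′ q q′ p≈p′ q≈q′ k = begin
    coeff (p +ₚ q) k           ≈⟨ coeff-+ p q k ⟩
    coeff p k + coeff q k      ≈⟨ +-cong (p≈p′ k) (q≈q′ k) ⟩
    coeff p′ k + coeff q′ k    ≈⟨ coeff-+ p′ q′ k ⟨
    coeff (p′ +ₚ q′) k         ∎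

  +ₚ-assoc : ∀ p q r → (p +ₚ q) +ₚ r ≈ₚ p +ₚ (q +ₚ r)
  +ₚ-assoc p q r k = begin
    coeff (p +ₚ q +ₚ r) k                  ≈⟨ coeff-+ (p +ₚ q) r k ⟩
    coeff (p +ₚ q) k + coeff r k           ≈⟨ +-congʳ (coeff-+ p q k) ⟩
    coeff p k + coeff q k + coeff r k      ≈⟨ +-assoc _ _ _ ⟩
    coeff p k + (coeff q k + coeff r k)    ≈⟨ +-congˡ (coeff-+ q r k) ⟨
    coeff p k + coeff (q +ₚ r) k           ≈⟨ coeff-+ p (q +ₚ r) k ⟨
    coeff (p +ₚ (q +ₚ r)) k                ∎

  +ₚ-comm : ∀ p q → p +ₚ q ≈ₚ q +ₚ p
  +ₚ-comm p q k = trans (coeff-+ p q k) (trans (+-comm _ _) (sym (coeff-+ q p k)))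

  +ₚ-identityʳ : ∀ p → p +ₚ [] ≈ₚ p
  +ₚ-identityʳ p k = trans (coeff-+ p [] k) (+-identityʳ _)

  +ₚ-inverseˡ : ∀ p → map -_ p +ₚ p ≈ₚ []
  +ₚ-inverseˡ p k = begin
    coeff (map -_ p +ₚ p) k          ≈⟨ coeff-+ (map -_ p) p k ⟩
    coeff (map -_ p) k + coeff p k   ≈⟨ +-congʳ (coeff-neg p k) ⟩
    - coeff p k + coeff p k          ≈⟨ -‿inverseˡ _ ⟩
    0#                               ∎

  -ₚ-cong : ∀ p q → p ≈ₚ q → map -_ p ≈ₚ map -_ q
  -ₚ-cong p q p≈q k = trans (coeff-neg p k) (trans (-‿cong (p≈q k)) (sym (coeff-neg q k)))

  -- A polynomial equal to zero may still be a nonempty list of zeros. This covers the cases of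
  -- `*ₚ-congʳ` in which one of two equal left factors is the empty list and the other need not be.
  *ₚ-zeroˡ : ∀ p q → p ≈ₚ [] → p *ₚ q ≈ₚ []
  *ₚ-zeroˡ []      q p≈0 k = refl
  *ₚ-zeroˡ (a ∷ p) q p≈0 k = begin
    coeff ((a ∷ p) *ₚ q) k                    ≈⟨ coeff-∷-* a p q k ⟩
    a * coeff q k + coeff (0# ∷ (p *ₚ q)) k   ≈⟨ +-cong (*-congʳ (p≈0 0)) (shift-cong (p *ₚ q) [] (*ₚ-zeroˡ p q (p≈0 ∘ suc)) k) ⟩
    0# * coeff q k + coeff (0# ∷ []) k        ≈⟨ +-cong (zeroˡ _) (shift-zero k) ⟩
    0# + 0#                                   ≈⟨ +-identityˡ 0# ⟩
    0#                                        ∎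

  *ₚ-congˡ : ∀ p q q′ → q ≈ₚ q′ → p *ₚ q ≈ₚ p *ₚ q′
  *ₚ-congˡ []      q q′ q≈q′ k = refl
  *ₚ-congˡ (a ∷ p) q q′ q≈q′ k = begin
    coeff ((a ∷ p) *ₚ q) k                      ≈⟨ coeff-∷-* a p q k ⟩
    a * coeff q k + coeff (0# ∷ (p *ₚ q)) k     ≈⟨ +-cong (*-congˡ (q≈q′ k)) (shift-cong _ _ (*ₚ-congˡ p q q′ q≈q′) k) ⟩
    a * coeff q′ k + coeff (0# ∷ (p *ₚ q′)) k   ≈⟨ coeff-∷-* a p q′ k ⟨
    coeff ((a ∷ p) *ₚ q′) k                     ∎

  *ₚ-congʳ : ∀ p p′ q → p ≈ₚ p′ → p *ₚ q ≈ₚ p′ *ₚ q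
  *ₚ-congʳ []      p′       q p≈p′ k = sym (*ₚ-zeroˡ p′ q (sym ∘ p≈p′) k)
  *ₚ-congʳ (a ∷ p) []       q p≈p′ k = *ₚ-zeroˡ (a ∷ p) q p≈p′ k
  *ₚ-congʳ (a ∷ p) (b ∷ p′) q p≈p′ k = begin
    coeff ((a ∷ p) *ₚ q) k                      ≈⟨ coeff-∷-* a p q k ⟩
    a * coeff q k + coeff (0# ∷ (p *ₚ q)) k     ≈⟨ +-cong (*-congʳ (p≈p′ 0)) (shift-cong _ _ (*ₚ-congʳ p p′ q (p≈p′ ∘ suc)) k) ⟩
    b * coeff q k + coeff (0# ∷ (p′ *ₚ q)) k    ≈⟨ coeff-∷-* b p′ q k ⟨
    coeff ((b ∷ p′) *ₚ q) k                     ∎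

  *ₚ-distribˡ : ∀ p q r → p *ₚ (q +ₚ r) ≈ₚ p *ₚ q +ₚ p *ₚ r
  *ₚ-distribˡ []      q r k = refl
  *ₚ-distribˡ (a ∷ p) q r k = begin
    coeff ((a ∷ p) *ₚ (q +ₚ r)) k
      ≈⟨ coeff-∷-* a p (q +ₚ r) k ⟩
    a * coeff (q +ₚ r) k + coeff (0# ∷ (p *ₚ (q +ₚ r))) k
      ≈⟨ +-cong (*-congˡ (coeff-+ q r k)) (shift-cong _ _ (*ₚ-distribˡ p q r) k) ⟩
    a * (coeff q k + coeff r k) + coeff (0# ∷ (p *ₚ q +ₚ p *ₚ r)) k
      ≈⟨ +-cong (distribˡ a _ _) (coeff-shift-+ (p *ₚ q) (p *ₚ r) k) ⟩
    (a * coeff q k + a * coeff r k) + (coeff (0# ∷ (p *ₚ q)) k + coeff (0# ∷ (p *ₚ r)) k)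
      ≈⟨ interchange _ _ _ _ ⟩
    (a * coeff q k + coeff (0# ∷ (p *ₚ q)) k) + (a * coeff r k + coeff (0# ∷ (p *ₚ r)) k)
      ≈⟨ +-cong (coeff-∷-* a p q k) (coeff-∷-* a p r k) ⟨
    coeff ((a ∷ p) *ₚ q) k + coeff ((a ∷ p) *ₚ r) k
      ≈⟨ coeff-+ ((a ∷ p) *ₚ q) ((a ∷ p) *ₚ r) k ⟨
    coeff ((a ∷ p) *ₚ q +ₚ (a ∷ p) *ₚ r) k
      ∎

  *ₚ-distribʳ : ∀ r p q → (p +ₚ q) *ₚ r ≈ₚ p *ₚ r +ₚ q *ₚ r
  *ₚ-distribʳ r []      q       k = refl
  *ₚ-distribʳ r (a ∷ p) []      k = sym (+ₚ-identityʳ ((a ∷ p) *ₚ r) k)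
  *ₚ-distribʳ r (a ∷ p) (b ∷ q) k = begin
    coeff (((a + b) ∷ (p +ₚ q)) *ₚ r) k
      ≈⟨ coeff-∷-* (a + b) (p +ₚ q) r k ⟩
    (a + b) * coeff r k + coeff (0# ∷ ((p +ₚ q) *ₚ r)) k
      ≈⟨ +-cong (distribʳ _ a b) (shift-cong _ _ (*ₚ-distribʳ r p q) k) ⟩
    (a * coeff r k + b * coeff r k) + coeff (0# ∷ (p *ₚ r +ₚ q *ₚ r)) k
      ≈⟨ +-congˡ (coeff-shift-+ (p *ₚ r) (q *ₚ r) k) ⟩
    (a * coeff r k + b * coeff r k) + (coeff (0# ∷ (p *ₚ r)) k + coeff (0# ∷ (q *ₚ r)) k)
      ≈⟨ interchange _ _ _ _ ⟩
    (a * coeff r k + coeff (0# ∷ (p *ₚ r)) k) + (b * coeff r k + coeff (0# ∷ (q *ₚ r)) k)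
      ≈⟨ +-cong (coeff-∷-* a p r k) (coeff-∷-* b q r k) ⟨
    coeff ((a ∷ p) *ₚ r) k + coeff ((b ∷ q) *ₚ r) k
      ≈⟨ coeff-+ ((a ∷ p) *ₚ r) ((b ∷ q) *ₚ r) k ⟨
    coeff ((a ∷ p) *ₚ r +ₚ (b ∷ q) *ₚ r) k
      ∎

  -- The contribution of a single coefficient of the left factor to associativity.
  scale-* : ∀ a p q → scale a p *ₚ q ≈ₚ scale a (p *ₚ q)
  scale-* a []      q k = refl
  scale-* a (b ∷ p) q k = begin
    coeff ((a * b ∷ scale a p) *ₚ q) k                    ≈⟨ coeff-∷-* (a * b) (scale a p) q k ⟩
    a * b * coeff q k + coeff (0# ∷ (scale a p *ₚ q)) k   ≈⟨ +-cong (*-assoc a b _) (shift-cong _ _ (scale-* a p q) k) ⟩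
    a * (b * coeff q k) + coeff (0# ∷ scale a (p *ₚ q)) k ≈⟨ +-congˡ (coeff-shift-scale a (p *ₚ q) k) ⟩
    a * (b * coeff q k) + a * coeff (0# ∷ (p *ₚ q)) k     ≈⟨ distribˡ a _ _ ⟨
    a * (b * coeff q k + coeff (0# ∷ (p *ₚ q)) k)         ≈⟨ *-congˡ (coeff-∷-* b p q k) ⟨
    a * coeff ((b ∷ p) *ₚ q) k                            ≈⟨ coeff-scale a ((b ∷ p) *ₚ q) k ⟨
    coeff (scale a ((b ∷ p) *ₚ q)) k                      ∎

  *ₚ-assoc : ∀ p q r → (p *ₚ q) *ₚ r ≈ₚ p *ₚ (q *ₚ r)
  *ₚ-assoc []      q r k = refl
  *ₚ-assoc (a ∷ p) q r k = begin
    coeff ((scale a q +ₚ (0# ∷ (p *ₚ q))) *ₚ r) k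
      ≈⟨ *ₚ-distribʳ r (scale a q) (0# ∷ (p *ₚ q)) k ⟩
    coeff (scale a q *ₚ r +ₚ (0# ∷ (p *ₚ q)) *ₚ r) k
      ≈⟨ coeff-+ (scale a q *ₚ r) ((0# ∷ (p *ₚ q)) *ₚ r) k ⟩
    coeff (scale a q *ₚ r) k + coeff ((0# ∷ (p *ₚ q)) *ₚ r) k
      ≈⟨ +-cong (scale-* a q r k) (coeff-shift-* (p *ₚ q) r k) ⟩
    coeff (scale a (q *ₚ r)) k + coeff (0# ∷ (p *ₚ q *ₚ r)) k
      ≈⟨ +-cong (coeff-scale a (q *ₚ r) k) (shift-cong _ _ (*ₚ-assoc p q r) k) ⟩
    a * coeff (q *ₚ r) k + coeff (0# ∷ (p *ₚ (q *ₚ r))) k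
      ≈⟨ coeff-∷-* a p (q *ₚ r) k ⟨
    coeff ((a ∷ p) *ₚ (q *ₚ r)) k
      ∎

  *ₚ-identityˡ : ∀ p → const 1# *ₚ p ≈ₚ p
  *ₚ-identityˡ p k = trans (coeff-const-* 1# p k) (*-identityˡ _)

  *ₚ-identityʳ : ∀ p → p *ₚ const 1# ≈ₚ p
  *ₚ-identityʳ []      k = refl
  *ₚ-identityʳ (a ∷ p) k = begin
    coeff ((a ∷ p) *ₚ const 1#) k
      ≈⟨ coeff-∷-* a p (const 1#) k ⟩
    a * coeff (const 1#) k + coeff (0# ∷ (p *ₚ const 1#)) k
      ≈⟨ +-congˡ (shift-cong _ p (*ₚ-identityʳ p) k) ⟩
    a * coeff (const 1#) k + coeff (0# ∷ p) k
      ≈⟨ head-tail k ⟩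
    coeff (a ∷ p) k
      ∎
    where
    head-tail : ∀ k → a * coeff (const 1#) k + coeff (0# ∷ p) k ≈ coeff (a ∷ p) k
    head-tail zero    = trans (+-identityʳ _) (*-identityʳ a)
    head-tail (suc k) = trans (+-congʳ (zeroʳ a)) (+-identityˡ _)

  -- Its operations are those of `polyRing`, so determinant identities proved over an arbitrary ring
  -- apply to the determinant in `charPoly`.
  polynomialRing : Ring c ℓ
  polynomialRing = record
    { Carrier = Poly
    ; _≈_     = _≈ₚ_
    ; _+_     = _+ₚ_
    ; _*_     = _*ₚ_
    ; -_      = map -_
    ; 0#      = []
    ; 1#      = const 1#
    ; isRing  = record
      { +-isAbelianGroup = record
        { isGroup = record
          { isMonoid = record
            { isSemigroup = record
              { isMagma = record
                { isEquivalence = record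
                  { refl  = λ k → refl
                  ; sym   = λ p≈q k → sym (p≈q k)
                  ; trans = λ p≈q q≈r k → trans (p≈q k) (q≈r k)
                  }
                ; ∙-cong = λ {p} {p′} {q} {q′} → +ₚ-cong p p′ q q′
                }
              ; assoc = +ₚ-assoc
              }
            ; identity = (λ p k → refl) , +ₚ-identityʳ
            }
          ; inverse = +ₚ-inverseˡ , (λ p k → trans (+ₚ-comm p (map -_ p) k) (+ₚ-inverseˡ p k))
          ; ⁻¹-cong = λ {p} {q} → -ₚ-cong p q
          }
        ; comm = +ₚ-comm
        }
      ; *-cong     = λ {p} {p′} {q} {q′} p≈p′ q≈q′ k →
          trans (*ₚ-congʳ p p′ q p≈p′ k) (*ₚ-congˡ p′ q q′ q≈q′ k)
      ; *-assoc    = *ₚ-assoc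
      ; *-identity = *ₚ-identityˡ , *ₚ-identityʳ
      ; distrib    = *ₚ-distribˡ , *ₚ-distribʳ
      }
    }

  -- Coefficients of powers of X and of their linear combinations.

  open RawSemiringDefs (RawRing.rawSemiring polyRing)
    using () renaming (sum to sumₚ; _^_ to _^ₚ_)
  open SemiringSum semiring using (sum; sum-cong-≋)

  coeff-X-* : ∀ p k → coeff (X *ₚ p) k ≈ coeff (0# ∷ p) k
  coeff-X-* p k = trans (coeff-shift-* (const 1#) p k) (shift-cong _ p (*ₚ-identityˡ p) k)

  coeff-X^-same : ∀ k → coeff (X ^ₚ k) k ≈ 1#
  coeff-X^-same zero    = refl
  coeff-X^-same (suc k) = trans (coeff-X-* (X ^ₚ k) (suc k)) (coeff-X^-same k)

  coeff-X^-other : ∀ j k → j ≢ k → coeff (X ^ₚ j) k ≈ 0#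
  coeff-X^-other zero    zero    j≢k = contradiction ≡.refl j≢k
  coeff-X^-other zero    (suc k) j≢k = refl
  coeff-X^-other (suc j) zero    j≢k = coeff-X-* (X ^ₚ j) zero
  coeff-X^-other (suc j) (suc k) j≢k =
    trans (coeff-X-* (X ^ₚ j) (suc k)) (coeff-X^-other j k (j≢k ∘ ≡.cong suc))

  coeff-sum : ∀ {n} (f : Vector Poly n) k → coeff (sumₚ f) k ≈ sum (λ i → coeff (f i) k)
  coeff-sum {zero}  f k = refl
  coeff-sum {suc n} f k = trans (coeff-+ (f zero) _ k) (+-congˡ (coeff-sum (f ∘ suc) k))

  coeff-geometric : ∀ {n} (i : Fin n) → coeff (sumₚ {n} (λ j → X ^ₚ toℕ j)) (toℕ i) ≈ 1#
  coeff-geometric {n} i = begin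
    coeff (sumₚ {n} (λ j → X ^ₚ toℕ j)) (toℕ i)
      ≈⟨ coeff-sum {n} (λ j → X ^ₚ toℕ j) (toℕ i) ⟩
    sum {n} (λ j → coeff (X ^ₚ toℕ j) (toℕ i))
      ≈⟨ sum-single +-monoid {n} _ i (λ j j≢i →
           coeff-X^-other (toℕ j) (toℕ i) (j≢i ∘ toℕ-injective)) ⟩
    coeff (X ^ₚ toℕ i) (toℕ i)
      ≈⟨ coeff-X^-same (toℕ i) ⟩
    1#
      ∎

  coeff-expansion : ∀ {n} (a : Vector Carrier n) i →
                    coeff (sumₚ (λ j → const (a j) *ₚ X ^ₚ toℕ j)) (toℕ i) ≈ a i
  coeff-expansion {n} a i = begin
    coeff (sumₚ (λ j → const (a j) *ₚ X ^ₚ toℕ j)) (toℕ i)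
      ≈⟨ coeff-sum {n} (λ j → const (a j) *ₚ X ^ₚ toℕ j) (toℕ i) ⟩
    sum (λ j → coeff (const (a j) *ₚ X ^ₚ toℕ j) (toℕ i))
      ≈⟨ sum-cong-≋ {n} (λ j → coeff-const-* (a j) (X ^ₚ toℕ j) (toℕ i)) ⟩
    sum (λ j → a j * coeff (X ^ₚ toℕ j) (toℕ i))
      ≈⟨ sum-single +-monoid _ i (λ j j≢i →
           trans (*-congˡ (coeff-X^-other (toℕ j) (toℕ i) (j≢i ∘ toℕ-injective))) (zeroʳ (a j))) ⟩
    a i * coeff (X ^ₚ toℕ i) (toℕ i)
      ≈⟨ *-congˡ (coeff-X^-same (toℕ i)) ⟩
    a i * 1#
      ≈⟨ *-identityʳ (a i) ⟩
    a i
      ∎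

-- Identity and reflection matrices.

module MatrixProperties (R : Ring c ℓ) where

  open Ring R hiding (_-_; zero)
  open RingProperties R using (-0#≈0#; -1*x≈-x; -‿involutive)
  open SemiringSum semiring
    using (sum; sum-cong-≋; sum-permute; ∑-distrib-+)
  open RawSemiringDefs (RawRing.rawSemiring rawRing) using (_^_)
  open Matrices rawRing
  open SetoidReasoning setoid

  identity-same : ∀ {n} (i : Fin n) → identity i i ≡ 1#
  identity-same i = ≡.cong (if_then 1# else 0#) (dec-true (i ≟ i) ≡.refl)

  identity-other : ∀ {n} {i j : Fin n} → i ≢ j → identity i j ≡ 0#
  identity-other {i = i} {j} i≢j = ≡.cong (if_then 1# else 0#) (dec-false (i ≟ j) i≢j)

  identity-sym : ∀ {n} (i j : Fin n) → identity i j ≡ identity j i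
  identity-sym i j = ≡.cong (if_then 1# else 0#) (does-⇔ (mk⇔ ≡.sym ≡.sym) (i ≟ j) (j ≟ i))

  identity-inject₁ : ∀ {n} (i j : Fin n) → identity (inject₁ i) (inject₁ j) ≡ identity i j
  identity-inject₁ i j = ≡.cong (if_then 1# else 0#)
    (does-⇔ (mk⇔ inject₁-injective (≡.cong inject₁)) (inject₁ i ≟ inject₁ j) (i ≟ j))

  sum-identityˡ : ∀ {n} i (f : Vector Carrier n) → sum (λ k → identity i k * f k) ≈ f i
  sum-identityˡ {n} i f = begin
    sum (λ k → identity i k * f k)
      ≈⟨ sum-single +-monoid {n} _ i (λ k k≢i →
           trans (*-congʳ (reflexive (identity-other (k≢i ∘ ≡.sym)))) (zeroˡ _)) ⟩
    identity i i * f i  ≈⟨ *-congʳ (reflexive (identity-same i)) ⟩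
    1# * f i            ≈⟨ *-identityˡ _ ⟩
    f i                 ∎

  sum-identityʳ : ∀ {n} j (f : Vector Carrier n) → sum (λ k → f k * identity k j) ≈ f j
  sum-identityʳ {n} j f = begin
    sum (λ k → f k * identity k j)
      ≈⟨ sum-single +-monoid {n} _ j (λ k k≢j →
           trans (*-congˡ (reflexive (identity-other k≢j))) (zeroʳ _)) ⟩
    f j * identity j j  ≈⟨ *-congˡ (reflexive (identity-same j)) ⟩
    f j * 1#            ≈⟨ *-identityʳ _ ⟩
    f j                 ∎

  -- With this form, a sum against a row of the reflection collapses just as one against a row of
  -- the identity does.
  reflection≡identity-opposite : ∀ {n} (i j : Fin n) → reflection i j ≡ identity (opposite i) j
  reflection≡identity-opposite {n} i j = ≡.cong (if_then 1# else 0#)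
    (does-⇔ (mk⇔ to from) (suc (toℕ i) ℕ.+ suc (toℕ j) ℕ.≟ n ℕ.+ 1) (opposite i ≟ j))
    where
    module E = ≡.≡-Reasoning
    to : suc (toℕ i) ℕ.+ suc (toℕ j) ≡ n ℕ.+ 1 → opposite i ≡ j
    to eq = toℕ-injective $ E.begin
      toℕ (opposite i)                          E.≡⟨ opposite-prop i ⟩
      n ℕ.∸ suc (toℕ i)                         E.≡⟨ ≡.cong (ℕ._∸ suc (toℕ i)) sum≡n ⟨
      suc (toℕ i) ℕ.+ toℕ j ℕ.∸ suc (toℕ i)     E.≡⟨ ℕ.m+n∸m≡n (suc (toℕ i)) (toℕ j) ⟩
      toℕ j                                     E.∎
      where
      sum≡n : suc (toℕ i) ℕ.+ toℕ j ≡ n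
      sum≡n = ℕ.suc-injective
        (≡.trans (≡.sym (ℕ.+-suc (suc (toℕ i)) (toℕ j))) (≡.trans eq (ℕ.+-comm n 1)))
    from : opposite i ≡ j → suc (toℕ i) ℕ.+ suc (toℕ j) ≡ n ℕ.+ 1
    from ≡.refl = E.begin
      suc (toℕ i) ℕ.+ suc (toℕ (opposite i))    E.≡⟨ ℕ.+-suc (suc (toℕ i)) _ ⟩
      suc (suc (toℕ i) ℕ.+ toℕ (opposite i))    E.≡⟨ ≡.cong (λ x → suc (suc (toℕ i) ℕ.+ x)) (opposite-prop i) ⟩
      suc (suc (toℕ i) ℕ.+ (n ℕ.∸ suc (toℕ i))) E.≡⟨ ≡.cong suc (ℕ.m+[n∸m]≡n (toℕ<n i)) ⟩
      suc n                                     E.≡⟨ ℕ.+-comm 1 n ⟩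
      n ℕ.+ 1                                   E.∎

  reflection-sym : ∀ {n} (i j : Fin n) → reflection i j ≡ reflection j i
  reflection-sym {n} i j = ≡.cong (λ s → if does (s ℕ.≟ n ℕ.+ 1) then 1# else 0#)
    (ℕ.+-comm (suc (toℕ i)) (suc (toℕ j)))

  -- The left factor reverses the order of the rows and the right factor that of the columns.
  reflection-conjugate : ∀ {n} (M : Matrix n) i j →
                         (reflection · M · reflection) i j ≈ M (opposite i) (opposite j)
  reflection-conjugate {n} M i j = begin
    sum (λ k → (reflection · M) i k * reflection k j)
      ≈⟨ sum-cong-≋ {n} (λ k → *-cong (left k)
           (trans (reflexive (≡.trans (reflection-sym k j) (reflection≡identity-opposite j k)))
                  (reflexive (identity-sym (opposite j) k)))) ⟩
    sum (λ k → M (opposite i) k * identity k (opposite j))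
      ≈⟨ sum-identityʳ (opposite j) (M (opposite i)) ⟩
    M (opposite i) (opposite j)
      ∎
    where
    left : ∀ k → (reflection · M) i k ≈ M (opposite i) k
    left k = trans
      (sum-cong-≋ {n} (λ l → *-congʳ (reflexive (reflection≡identity-opposite i l))))
      (sum-identityˡ (opposite i) (λ l → M l k))

  -- Determinants of Hessenberg matrices.

  det-cong : ∀ {n} {M N : Matrix n} → M ≈ᴹ N → det M ≈ det N
  det-cong {zero}  M≈N = refl
  det-cong {suc n} M≈N = sum-cong-≋ {suc n} λ j →
    *-congˡ {(- 1#) ^ toℕ j} (*-cong (M≈N zero j) (det-cong (λ i k → M≈N (suc i) (punchIn j k))))

  -- The shape of x I - L: outside the first column, x on the diagonal and -1 just above it. The
  -- first column is left free so that the minors met in the Laplace expansion stay in the family.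
  hessenberg : ∀ {n} → Carrier → Vector Carrier n → Matrix n
  hessenberg x v i zero    = v i
  hessenberg x v i (suc j) = x * identity i (suc j) + - identity i (inject₁ j)

  -- This is the value of the Hessenberg determinant when the first column is x e₀, that is, for an
  -- upper triangular matrix with x along the diagonal. It serves both the first minor and the
  -- leading term of χ.
  sum-leading : ∀ {n} x →
    sum {suc n} (λ i → x * identity i zero * x ^ toℕ (opposite i)) ≈ x ^ suc n
  sum-leading {n} x = begin
    sum {suc n} (λ i → x * identity i zero * x ^ toℕ (opposite i))
      ≈⟨ sum-single +-monoid {suc n} _ zero (λ k k≢0 → trans (*-congʳ {x ^ toℕ (opposite k)}
           (trans (*-congˡ (reflexive (identity-other k≢0))) (zeroʳ x))) (zeroˡ _)) ⟩
    x * 1# * x ^ toℕ (fromℕ n)   ≈⟨ *-cong (*-identityʳ x) (reflexive (≡.cong (x ^_) (toℕ-fromℕ n))) ⟩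
    x ^ suc n                    ∎

  -- In the expansion along the first row only the first two minors survive: the first one
  -- is again a Hessenberg matrix, with first column x e₀, and the second one is the
  -- Hessenberg matrix of the tail of v.
  det-hessenberg : ∀ {n} x (v : Vector Carrier (suc n)) →
                   det (hessenberg x v) ≈ sum (λ i → v i * x ^ toℕ (opposite i))
  det-hessenberg {zero}  x v = +-congʳ (*-identityˡ _)
  det-hessenberg {suc n} x v = +-cong first (trans (+-cong second rest) (+-identityʳ _))
    where
    minor : Fin (suc (suc n)) → Matrix (suc n)
    minor j i k = hessenberg x v (suc i) (punchIn j k)

    x·e₀ : Vector Carrier (suc n)
    x·e₀ i = x * identity i zero

    minor₀ : minor zero ≈ᴹ hessenberg x x·e₀
    -- The -1 of the second column stood in the deleted top row, which leaves only its diagonal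
    -- entry x.
    minor₀ i zero    = trans (+-congˡ -0#≈0#) (+-identityʳ _)
    minor₀ i (suc k) = refl

    minor₁ : minor (suc zero) ≈ᴹ hessenberg x (v ∘ suc)
    minor₁ i zero    = refl
    minor₁ i (suc k) = refl

    first : 1# * (v zero * det (minor zero)) ≈ v zero * x ^ suc (toℕ (fromℕ n))
    first = begin
      1# * (v zero * det (minor zero))   ≈⟨ *-identityˡ _ ⟩
      v zero * det (minor zero)          ≈⟨ *-congˡ (det-cong {suc n} minor₀) ⟩
      v zero * det (hessenberg x x·e₀)   ≈⟨ *-congˡ (det-hessenberg x x·e₀) ⟩
      v zero * sum (λ i → x·e₀ i * x ^ toℕ (opposite i))
                                         ≈⟨ *-congˡ (sum-leading {n} x) ⟩
      v zero * x ^ suc n                 ≡⟨ ≡.cong (λ k → v zero * x ^ suc k) (toℕ-fromℕ n) ⟨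
      v zero * x ^ suc (toℕ (fromℕ n))   ∎

    -- The cofactor sign and the entry above the diagonal are both -1 and cancel.
    second : - 1# * 1# * ((x * 0# + - 1#) * det (minor (suc zero)))
           ≈ sum (λ i → v (suc i) * x ^ toℕ (opposite (suc i)))
    second = begin
      - 1# * 1# * ((x * 0# + - 1#) * det (minor (suc zero)))
        ≈⟨ *-cong (*-identityʳ _) (*-congʳ (trans (+-congʳ (zeroʳ x)) (+-identityˡ _))) ⟩
      - 1# * (- 1# * det (minor (suc zero)))
        ≈⟨ trans (-1*x≈-x _) (-‿cong (-1*x≈-x _)) ⟩
      - - det (minor (suc zero))
        ≈⟨ -‿involutive _ ⟩
      det (minor (suc zero))
        ≈⟨ det-cong minor₁ ⟩
      det (hessenberg x (v ∘ suc))
        ≈⟨ det-hessenberg x (v ∘ suc) ⟩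
      sum (λ i → v (suc i) * x ^ toℕ (opposite i))
        ≈⟨ sum-cong-≋ {suc n} (λ i → *-congˡ {v (suc i)}
             (reflexive (≡.cong (x ^_) (≡.sym (toℕ-inject₁ (opposite i)))))) ⟩
      sum (λ i → v (suc i) * x ^ toℕ (opposite (suc i)))
        ∎

    rest : sum (λ (j : Fin n) → (- 1#) ^ toℕ (suc (suc j)) *
             (hessenberg x v zero (suc (suc j)) * det (minor (suc (suc j))))) ≈ 0#
    rest = sum-zero +-monoid {n} _ λ j → begin
      _ * ((x * 0# + - 0#) * _)   ≈⟨ *-congˡ (*-congʳ (+-cong (zeroʳ x) -0#≈0#)) ⟩
      _ * ((0# + 0#) * _)         ≈⟨ *-congˡ (*-congʳ (+-identityˡ 0#)) ⟩
      _ * (0# * _)                ≈⟨ *-congˡ (zeroˡ _) ⟩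
      _ * 0#                      ≈⟨ zeroʳ _ ⟩
      0#                          ∎

  -- The determinant formula is linear in the first column, which splits into x e₀, giving the
  -- leading power, and the negated coefficients. Reversing the order of summation undoes `opposite`
  -- in the latter.
  det-companion : ∀ {n} x (a : Vector Carrier (suc n)) →
    det (hessenberg x (λ i → x * identity i zero + - a (opposite i))) ≈
    x ^ suc n + sum (λ j → - a j * x ^ toℕ j)
  det-companion {n} x a = begin
    det (hessenberg x (λ i → x * identity i zero + - a (opposite i)))
      ≈⟨ det-hessenberg x (λ i → x * identity i zero + - a (opposite i)) ⟩
    sum (λ i → (x * identity i zero + - a (opposite i)) * x ^ toℕ (opposite i))
      ≈⟨ sum-cong-≋ {suc n} (λ i → distribʳ (x ^ toℕ (opposite i)) (x * identity i zero) (- a (opposite i))) ⟩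
    sum (λ i → x * identity i zero * x ^ toℕ (opposite i) + - a (opposite i) * x ^ toℕ (opposite i))
      ≈⟨ ∑-distrib-+ (λ i → x * identity i zero * x ^ toℕ (opposite i))
                      (λ i → - a (opposite i) * x ^ toℕ (opposite i)) ⟩
    sum {suc n} (λ i → x * identity i zero * x ^ toℕ (opposite i)) +
    sum (λ i → - a (opposite i) * x ^ toℕ (opposite i))
      ≈⟨ +-cong (sum-leading {n} x) (sym (sum-permute (λ j → - a j * x ^ toℕ j) Perm.reverse)) ⟩
    x ^ suc n + sum (λ j → - a j * x ^ toℕ j)
      ∎

-- The characteristic polynomial of the companion matrix.

module CompanionPolynomial (R : Ring c ℓ) where

  open Ring R hiding (_-_; zero)
  open Polynomial rawRing
  open Matrices rawRing using (companion)
  open CharacteristicPolynomial rawRing using (charPoly)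
  open RingProperties R using (-0#≈0#)
  open PolynomialRing R
  open MatrixProperties polynomialRing using (hessenberg; det-cong; det-companion)
  open SemiringSum (Ring.semiring polynomialRing) using (sum-cong-≋; sum-init-last)
  open RawSemiringDefs (RawRing.rawSemiring polyRing)
    using () renaming (sum to sumₚ; _^_ to _^ₚ_)
  open SetoidReasoning setoid
  open Matrices polyRing using (Matrix; identity; _≈ᴹ_)

  charPoly-companion : ∀ {n} (p : Vector Carrier (suc n)) →
    charPoly (companion p) ≈ₚ X ^ₚ suc n +ₚ sumₚ (λ j → const (- p j) *ₚ X ^ₚ toℕ j)
  charPoly-companion {n} p k = trans
    (det-cong {M = λ i j → X *ₚ identity i j +ₚ map -_ (const (companion p i j))} {N = H} entries k)
    (det-companion X (λ j → const (p j)) k)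
    where
    H : Matrix (suc n)
    H = hessenberg X (λ i → X *ₚ identity i zero +ₚ map -_ (const (p (opposite i))))

    -- A zero entry of L becomes the list `const 0#`, while the zero entry of the identity over
    -- polynomials is `[]`. They agree only up to trailing zeros.
    const-if : ∀ b → map -_ (const (if b then 1# else 0#)) ≈ₚ map -_ (if b then const 1# else [])
    const-if true  k = refl
    const-if false k = trans (∷-≈ k) (shift-zero k)
      where
      ∷-≈ : (- 0# ∷ []) ≈ₚ (0# ∷ [])
      ∷-≈ zero    = -0#≈0#
      ∷-≈ (suc k) = refl

    entries : (λ i j → X *ₚ identity i j +ₚ map -_ (const (companion p i j))) ≈ᴹ H
    entries i zero    = λ k → refl
    entries i (suc j) = +ₚ-cong X*δ X*δ
      (map -_ (const (companion p i (suc j)))) (map -_ (identity i (inject₁ j)))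
      (λ k → refl) (const-if (does (i ≟ inject₁ j)))
      where X*δ = X *ₚ identity i (suc j)

  coeff-charPoly-companion : ∀ {n} (p : Vector Carrier (suc n)) i →
                             coeff (charPoly (companion p)) (toℕ i) ≈ - p i
  coeff-charPoly-companion {n} p i = begin
    coeff (charPoly (companion p)) (toℕ i)
      ≈⟨ charPoly-companion p (toℕ i) ⟩
    coeff (X ^ₚ suc n +ₚ sumₚ (λ j → const (- p j) *ₚ X ^ₚ toℕ j)) (toℕ i)
      ≈⟨ coeff-+ (X ^ₚ suc n) _ (toℕ i) ⟩
    coeff (X ^ₚ suc n) (toℕ i) + coeff (sumₚ (λ j → const (- p j) *ₚ X ^ₚ toℕ j)) (toℕ i)
      -- The degree `toℕ i` is at most n, so the leading power does not contribute.
      ≈⟨ +-cong (coeff-X^-other (suc n) (toℕ i) (ℕ.>⇒≢ (toℕ<n i)))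
                (coeff-expansion (λ j → - p j) i) ⟩
    0# + - p i
      ≈⟨ +-identityˡ _ ⟩
    - p i
      ∎

  -- Both sides have leading term X^(n+1), so only the coefficients up to degree n have to be
  -- compared. For the converse the last summand of the geometric sum is split off and the others
  -- match term by term.
  charPoly-companion-geometric : ∀ {n} (p : Vector Carrier (suc n)) →
    charPoly (companion p) ≈ₚ sumₚ {suc (suc n)} (λ j → X ^ₚ toℕ j) ⇔ (∀ i → - p i ≈ 1#)
  charPoly-companion-geometric {n} p = mk⇔ to from
    where
    geometric : Poly
    geometric = sumₚ {suc (suc n)} (λ j → X ^ₚ toℕ j)

    to : charPoly (companion p) ≈ₚ geometric → ∀ i → - p i ≈ 1#
    to χ≈ i = begin
      - p i                                    ≈⟨ coeff-charPoly-companion p i ⟨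
      coeff (charPoly (companion p)) (toℕ i)   ≈⟨ χ≈ (toℕ i) ⟩
      coeff geometric (toℕ i)                  ≡⟨ ≡.cong (coeff geometric) (toℕ-inject₁ i) ⟨
      coeff geometric (toℕ (inject₁ i))        ≈⟨ coeff-geometric (inject₁ i) ⟩
      1#                                       ∎

    from : (∀ i → - p i ≈ 1#) → charPoly (companion p) ≈ₚ geometric
    from -p≈1 k = begin
      coeff (charPoly (companion p)) k
        ≈⟨ charPoly-companion p k ⟩
      coeff (X ^ₚ suc n +ₚ lower) k
        ≈⟨ +ₚ-comm (X ^ₚ suc n) lower k ⟩
      coeff (lower +ₚ X ^ₚ suc n) k
        ≈⟨ +ₚ-cong lower init (X ^ₚ suc n) top
             (sum-cong-≋ {suc n} {λ j → const (- p j) *ₚ X ^ₚ toℕ j} {λ j → X ^ₚ toℕ (inject₁ j)} terms)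
             (λ k → reflexive (≡.cong (λ d → coeff (X ^ₚ d) k) (≡.sym (toℕ-fromℕ (suc n))))) k ⟩
      coeff (init +ₚ top) k
        ≈⟨ sum-init-last {suc n} (λ j → X ^ₚ toℕ j) k ⟨
      coeff geometric k
        ∎
      where
      lower init top : Poly
      lower = sumₚ (λ j → const (- p j) *ₚ X ^ₚ toℕ j)
      init  = sumₚ {suc n} (λ j → X ^ₚ toℕ (inject₁ j))
      top   = X ^ₚ toℕ (fromℕ (suc n))

      terms : ∀ j → const (- p j) *ₚ X ^ₚ toℕ j ≈ₚ X ^ₚ toℕ (inject₁ j)
      terms j k = begin
        coeff (const (- p j) *ₚ X ^ₚ toℕ j) k   ≈⟨ coeff-const-* (- p j) (X ^ₚ toℕ j) k ⟩
        - p j * coeff (X ^ₚ toℕ j) k            ≈⟨ *-congʳ (-p≈1 j) ⟩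
        1# * coeff (X ^ₚ toℕ j) k               ≈⟨ *-identityˡ _ ⟩
        coeff (X ^ₚ toℕ j) k                    ≡⟨ ≡.cong (λ d → coeff (X ^ₚ d) k) (toℕ-inject₁ j) ⟨
        coeff (X ^ₚ toℕ (inject₁ j)) k          ∎

-- Columns of the powers of the companion matrix.

module CompanionPowers (R : Ring c ℓ) where

  open Ring R hiding (zero)
  open SemiringSum semiring using (sum; sum-cong-≋)
  open Matrices rawRing
  open MatrixProperties R
  open SetoidReasoning setoid

  -- Rows are counted from the bottom, in step with the indices of p. The bottom row has no 1 to the
  -- right of its diagonal.
  companion-row-zero : ∀ {n} (p f : Vector Carrier (suc n)) →
    sum (λ k → companion p (opposite zero) k * f k) ≈ p zero * f zero
  companion-row-zero {n} p f = begin
    p (opposite (opposite zero)) * f zero + sum (λ k → identity (fromℕ n) (inject₁ k) * f (suc k))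
      ≈⟨ +-cong (*-congʳ (reflexive (≡.cong p (opposite-involutive zero))))
                (sum-zero +-monoid {n} _ λ k → trans
                  (*-congʳ {f (suc k)} (reflexive (identity-other (fromℕ≢inject₁ {i = k})))) (zeroˡ _)) ⟩
    p zero * f zero + 0#
      ≈⟨ +-identityʳ _ ⟩
    p zero * f zero
      ∎

  -- Every other row adds to its first-column entry a single 1 above the diagonal, which picks the
  -- entry of f one place lower in the matrix order.
  companion-row-suc : ∀ {n} (p f : Vector Carrier (suc n)) i →
    sum (λ k → companion p (opposite (suc i)) k * f k) ≈
    p (suc i) * f zero + f (opposite (inject₁ i))
  companion-row-suc {n} p f i = +-cong
    (*-congʳ (reflexive (≡.cong p (opposite-involutive (suc i)))))
    (begin
      sum (λ k → identity (inject₁ (opposite i)) (inject₁ k) * f (suc k))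
        ≈⟨ sum-cong-≋ {n} (λ k → *-congʳ {f (suc k)} (reflexive (identity-inject₁ (opposite i) k))) ⟩
      sum (λ k → identity (opposite i) k * f (suc k))
        ≈⟨ sum-identityˡ (opposite i) (f ∘ suc) ⟩
      f (suc (opposite i))
        ≡⟨ ≡.cong f opposite-inject₁ ⟨
      f (opposite (inject₁ i))
        ∎)
    where
    opposite-inject₁ : opposite (inject₁ i) ≡ suc (opposite i)
    opposite-inject₁ = ≡.trans
      (≡.cong (opposite ∘ inject₁) (≡.sym (opposite-involutive i)))
      (opposite-involutive (suc (opposite i)))

  -- Column `suc j` of L is the basis vector with index `inject₁ j`, which settles k = 0. Further
  -- left multiplications by L act on both columns alike.
  companion^-suc : ∀ {n} (p : Vector Carrier (suc n)) k i j →
                   (companion p ^ᴹ suc k) i (suc j) ≈ (companion p ^ᴹ k) i (inject₁ j)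
  companion^-suc p zero    i j = sum-identityʳ (suc j) (companion p i)
  companion^-suc p (suc k) i j =
    sum-cong-≋ (λ l → *-congˡ {companion p i l} (companion^-suc p k l j))

  -- The column shift is repeated until column zero is reached. The recursion runs on t because
  -- `inject₁ j` is not structurally smaller than `suc j`.
  companion^-shift : ∀ {n} (p : Vector Carrier (suc n)) t k i j → toℕ j ≡ t →
                     (companion p ^ᴹ (t ℕ.+ k)) i j ≈ (companion p ^ᴹ k) i zero
  companion^-shift p zero    k i zero    eq = refl
  companion^-shift p (suc t) k i (suc j) eq = trans
    (companion^-suc p (t ℕ.+ k) i j)
    (companion^-shift p t k i (inject₁ j) (≡.trans (toℕ-inject₁ j) (ℕ.suc-injective eq)))

  -- The first column of the k-th power, read from the bottom as p is.
  column : ∀ {n} → Vector Carrier (suc n) → ℕ → Vector Carrier (suc n)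
  column p k i = (companion p ^ᴹ k) (opposite i) zero

  column-one : ∀ {n} (p : Vector Carrier (suc n)) i → column p 1 i ≈ p i
  column-one p i = trans
    (sum-identityʳ zero (companion p (opposite i)))
    (reflexive (≡.cong p (opposite-involutive i)))

  -- Together with `column-suc` this is, over a commutative ring, multiplication by X modulo X^(n+1)
  -- - Σ pⱼ Xʲ: entries move up one degree and the one at `fromℕ n` is fed back through p.
  column-zero : ∀ {n} (p : Vector Carrier (suc n)) k →
                column p (suc k) zero ≈ p zero * column p k (fromℕ n)
  column-zero {n} p k = trans
    (companion-row-zero p (λ l → (companion p ^ᴹ k) l zero))
    (*-congˡ (reflexive (≡.cong (λ l → (companion p ^ᴹ k) l zero)
      (≡.sym (opposite-involutive {suc n} zero)))))

  column-suc : ∀ {n} (p : Vector Carrier (suc n)) k i →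
               column p (suc k) (suc i) ≈ p (suc i) * column p k (fromℕ n) + column p k (inject₁ i)
  column-suc {n} p k i = trans
    (companion-row-suc p (λ l → (companion p ^ᴹ k) l zero) i)
    (+-congʳ (*-congˡ (reflexive (≡.cong (λ l → (companion p ^ᴹ k) l zero)
      (≡.sym (opposite-involutive {suc n} zero))))))

  -- Conjugation selects column n - j of the power n + 1. Since n + 1 = (n - j) + (j + 1), shifting
  -- n - j times leads to column zero of the power j + 1.
  reflected-power : ∀ {n} (p : Vector Carrier (suc n)) i j →
    (reflection · companion p ^ᴹ suc n · reflection) i j ≈ column p (suc (toℕ j)) i
  reflected-power {n} p i j = begin
    (reflection · companion p ^ᴹ suc n · reflection) i j
      ≈⟨ reflection-conjugate (companion p ^ᴹ suc n) i j ⟩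
    (companion p ^ᴹ suc n) (opposite i) (opposite j)
      ≡⟨ ≡.cong (λ k → (companion p ^ᴹ k) (opposite i) (opposite j)) exponent ⟨
    (companion p ^ᴹ (toℕ (opposite j) ℕ.+ suc (toℕ j))) (opposite i) (opposite j)
      ≈⟨ companion^-shift p (toℕ (opposite j)) (suc (toℕ j)) (opposite i) (opposite j) ≡.refl ⟩
    column p (suc (toℕ j)) i
      ∎
    where
    exponent : toℕ (opposite j) ℕ.+ suc (toℕ j) ≡ suc n
    exponent = ≡.trans (≡.cong (ℕ._+ suc (toℕ j)) (opposite-prop j)) (ℕ.m∸n+n≡m (toℕ<n j))

-- The equivalence over the two-element field.

open import Defs
open import Data.Parity.Base using (Parity; 0ℙ; 1ℙ; _+_; _*_)

open CompanionPolynomial ℙ.+-*-ring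
  using (charPoly-companion-geometric)
open CompanionPowers ℙ.+-*-ring
open MatrixProperties ℙ.+-*-ring
  using (identity-other; identity-inject₁)
open ≡.≡-Reasoning

*≡1⇒≡1ˡ : ∀ {a b} → a * b ≡ 1ℙ → a ≡ 1ℙ
*≡1⇒≡1ˡ {1ℙ} _ = ≡.refl

*≡1⇒≡1ʳ : ∀ {a b} → a * b ≡ 1ℙ → b ≡ 1ℙ
*≡1⇒≡1ʳ {1ℙ} b≡1 = b≡1

+≡0∧≡1⇒≡1 : ∀ {a b} → a * 1ℙ + b ≡ 0ℙ → b ≡ 1ℙ → a ≡ 1ℙ
+≡0∧≡1⇒≡1 {1ℙ} _ _      = ≡.refl
+≡0∧≡1⇒≡1 {0ℙ} () ≡.refl

reflected⇒ones : ∀ {m} (p : Fin (suc (suc m)) → Parity) →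
  companion p ≈ᴹ reflection · companion p ^ᴹ suc (suc m) · reflection → ∀ i → p i ≡ 1ℙ
reflected⇒ones {m} p L≈ = <-weakInduction (λ i → p i ≡ 1ℙ) (*≡1⇒≡1ˡ ends) step
  where
  -- The matrix equation is read in column 1, which exists because the size is at least two.
  column-two : ∀ i → column p 2 i ≡ identity i zero
  column-two i = ≡.sym (≡.trans (L≈ i (suc zero)) (reflected-power p i (suc zero)))

  ends : p zero * p (fromℕ (suc m)) ≡ 1ℙ
  ends = begin
    p zero * p (fromℕ (suc m))            ≡⟨ ≡.cong (p zero *_) (column-one p _) ⟨
    p zero * column p 1 (fromℕ (suc m))   ≡⟨ column-zero p 1 ⟨
    column p 2 zero                       ≡⟨ column-two zero ⟩
    1ℙ                                    ∎

  -- Since pₙ₋₁ = 1 is already known from `ends`, the recurrence makes neighbouring coefficients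
  -- equal, and the value 1 spreads upward from p₀.
  step : ∀ i → p (inject₁ i) ≡ 1ℙ → p (suc i) ≡ 1ℙ
  step i = +≡0∧≡1⇒≡1 (begin
    p (suc i) * 1ℙ + p (inject₁ i)
      ≡⟨ ≡.cong₂ (λ a b → p (suc i) * a + b)
           (≡.trans (column-one p _) (*≡1⇒≡1ʳ {p zero} ends)) (column-one p _) ⟨
    p (suc i) * column p 1 (fromℕ (suc m)) + column p 1 (inject₁ i)
      ≡⟨ column-suc p 1 i ⟨
    column p 2 (suc i)
      ≡⟨ column-two (suc i) ⟩
    0ℙ
      ∎)

ones⇒reflected : ∀ {m} (p : Fin (suc (suc m)) → Parity) → (∀ i → p i ≡ 1ℙ) →
  companion p ≈ᴹ reflection · companion p ^ᴹ suc (suc m) · reflection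
ones⇒reflected {m} p p≡1 i j = ≡.trans (entry i j) (≡.sym (reflected-power p i j))
  where
  last = fromℕ (suc m)

  zero-step : ∀ k → column p (suc k) zero ≡ column p k last
  zero-step k = ≡.trans (column-zero p k) (≡.cong (_* column p k last) (p≡1 zero))

  suc-step : ∀ k i → column p (suc k) (suc i) ≡ column p k last + column p k (inject₁ i)
  suc-step k i = ≡.trans (column-suc p k i)
    (≡.cong (λ a → a * column p k last + column p k (inject₁ i)) (p≡1 (suc i)))

  -- The offset is two because the all-ones column comes from the first power, and only the second
  -- power gives a basis vector, the one with index zero.
  Shifted : Fin (suc m) → Set
  Shifted j = ∀ i → column p (suc (suc (toℕ j))) i ≡ identity i (inject₁ j)

  column-one≡1 : ∀ i → column p 1 i ≡ 1ℙ
  column-one≡1 i = ≡.trans (column-one p i) (p≡1 i)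

  base : Shifted zero
  base zero    = ≡.trans (zero-step 1) (column-one≡1 last)
  -- Here 1 + 1 = 0 clears every entry except the one with index zero.
  base (suc i) = ≡.trans (suc-step 1 i) (≡.cong₂ _+_ (column-one≡1 last) (column-one≡1 (inject₁ i)))

  step : ∀ j → Shifted (inject₁ j) → Shifted (suc j)
  step j IH = go
    where
    k = suc (suc (toℕ j))

    IH′ : ∀ i → column p k i ≡ identity i (inject₁ (inject₁ j))
    IH′ i = ≡.trans (≡.cong (λ t → column p (suc (suc t)) i) (≡.sym (toℕ-inject₁ j))) (IH i)

    -- The 1 has not yet reached the last place, so nothing is fed back and the recurrence only
    -- moves it one place on.
    column-last : column p k last ≡ 0ℙ
    column-last = ≡.trans (IH′ last) (identity-other (fromℕ≢inject₁ {i = inject₁ j}))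

    go : Shifted (suc j)
    go zero    = ≡.trans (zero-step k) column-last
    go (suc i) = begin
      column p (suc k) (suc i)                    ≡⟨ suc-step k i ⟩
      column p k last + column p k (inject₁ i)    ≡⟨ ≡.cong₂ _+_ column-last (IH′ (inject₁ i)) ⟩
      identity (inject₁ i) (inject₁ (inject₁ j))  ≡⟨ identity-inject₁ i (inject₁ j) ⟩
      identity i (inject₁ j)                      ∎

  entry : ∀ i j → companion p i j ≡ column p (suc (toℕ j)) i
  entry i zero    = ≡.trans (p≡1 (opposite i)) (≡.sym (column-one≡1 i))
  entry i (suc j) = ≡.sym (<-weakInduction Shifted base step j i)

reflected⇔ones : ∀ {m} (p : Fin (suc (suc m)) → Parity) →
  (companion p ≈ᴹ reflection · companion p ^ᴹ suc (suc m) · reflection) ⇔ (∀ i → p i ≡ 1ℙ)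
reflected⇔ones p = mk⇔ (reflected⇒ones p) (ones⇒reflected p)

theorem1p1 :
    (n : ℕ) → 2 ≤ n → (p : Fin n → Parity) →
    let L = companion p
        τ = reflection {n}
    in  (L ≈ᴹ τ · L ^ᴹ n · τ) ⇔ (charPoly L ≈ₚ sumₚ {suc n} (λ j → X ^ₚ toℕ j))
-- For n = 1 the matrix equation holds for either value of p₀, whereas the polynomial condition
-- forces p₀ = 1; hence the bound on n.
theorem1p1 (suc (suc m)) (s≤s (s≤s _)) p =
  -- Negation in 𝔽₂ is the identity, so `- p i ≈ 1#` and `p i ≡ 1ℙ` are the same condition.
  ⇔-sym (charPoly-companion-geometric p) ⇔-∘ reflected⇔ones p
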